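{- Let $d\ge 1$ and $n,k\ge 0$ be integers. Let $\mathcal{L}_{\leq d}(n,k)$ be the set of lonesum $0$-$1$ matrices with $n$ rows and $k$ columns that have no all-zero row and no all-zero column, and in which at most $d$ columns are of the same type and at most $d$ rows are of the same type. Then \[ |\mathcal{L}_{\leq d}(n,k)|=\sum_{m=0}^{\min(n,k)} m!\,S_{\leq d}(n,m)\; m!\,S_{\leq d}(k,m). \]
   Context: A $0$-$1$ matrix is lonesum if it is uniquely determined by its vector of row sums and its vector of column sums; equivalently, it contains no $2\times 2$ submatrix (rows $i<i'$, columns $j<j'$) equal to $\begin{pmatrix}1&0\\0&1\end{pmatrix}$ or $\begin{pmatrix}0&1\\1&0\end{pmatrix}$. The type of a column (resp. row) is the column (resp. row) vector itself; two columns have the same type iff they are identical vectors. $S_{\leq d}(n,m)$ denotes the restricted Stirling number of the second kind: the number of partitions of an $n$-element set into $m$ non-empty blocks each of size at most $d$ (with $S_{\le d}(0,0)=1$). -}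

module Defs where

open import Data.Bool using (Bool; true; false; if_then_else_)
import Data.Bool.Properties as Bool
open import Data.Fin.Properties using (all?)
open import Data.Fin.Subset using (Subset; inside; outside; Nonempty; Empty; _∈_; _∩_; ∣_∣)
open import Data.Fin.Subset.Properties using (nonempty?; _∈?_)
open import Data.List as List using (List; []; _∷_; _++_; length; filter)
open import Data.List.Membership.Propositional using () renaming (_∈_ to _∈ˡ_)
open import Data.List.Relation.Unary.All as ListAll using ()
open import Data.List.Relation.Unary.AllPairs using (AllPairs; allPairs?)
open import Data.List.Relation.Unary.Any as ListAny using ()
open import Data.List.Relation.Unary.Unique.Propositional using (Unique)
open import Data.Nat using (ℕ; zero; suc; _≤_; _≤?_)
open import Data.Product using (∃-syntax; _×_)
open import Data.Vec as Vec using (Vec; []; _∷_; count; replicate; transpose)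
open import Data.Vec.Properties using (≡-dec)
open import Data.Vec.Relation.Unary.All as VecAll using ()
open import Function.Bundles using (_⇔_)
open import Relation.Binary.PropositionalEquality using (_≡_; _≢_)
open import Relation.Nullary using (Dec; ¬?)
open import Relation.Nullary.Decidable using (_×-dec_)

HasCardinality : {A : Set} → (A → Set) → ℕ → Set
HasCardinality {A} P c =
  ∃[ xs ] Unique xs × (∀ (x : A) → x ∈ˡ xs ⇔ P x) × length xs ≡ c

-- Matrices are vectors of rows, with true standing for 1 and false for 0.
Matrix : ℕ → ℕ → Set
Matrix n k = Vec (Vec Bool k) n

entry : Bool → ℕ
entry b = if b then 1 else 0

rowSums : ∀ {n k} → Matrix n k → Vec ℕ n
rowSums A = Vec.map (λ r → Vec.sum (Vec.map entry r)) A

columnSums : ∀ {n k} → Matrix n k → Vec ℕ k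
columnSums A = rowSums (transpose A)

Lonesum : ∀ {n k} → Matrix n k → Set
Lonesum {n} {k} A =
  (B : Matrix n k) → rowSums B ≡ rowSums A → columnSums B ≡ columnSums A → B ≡ A

NoZeroRow : ∀ {n k} → Matrix n k → Set
NoZeroRow {k = k} A = VecAll.All (_≢ replicate k false) A

AtMostRowsOfSameType : ∀ {n k} → ℕ → Matrix n k → Set
AtMostRowsOfSameType {k = k} d A =
  (t : Vec Bool k) → count (λ r → ≡-dec Bool._≟_ r t) A ≤ d

record 𝓛≤ (d n k : ℕ) (A : Matrix n k) : Set where
  field
    lonesum       : Lonesum A
    noZeroRow     : NoZeroRow A
    noZeroColumn  : NoZeroRow (transpose A)
    columnsOfType : AtMostRowsOfSameType d (transpose A)
    rowsOfType    : AtMostRowsOfSameType d A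

subsets : (n : ℕ) → List (Subset n)
subsets zero    = [] ∷ []
subsets (suc n) = List.map (inside ∷_) (subsets n) ++ List.map (outside ∷_) (subsets n)

-- Sublists of length m.  Applied to a duplicate-free list, this enumerates
-- each m-element set of entries exactly once.
choose : {A : Set} → ℕ → List A → List (List A)
choose zero    _        = [] ∷ []
choose (suc m) []       = []
choose (suc m) (x ∷ xs) = List.map (x ∷_) (choose m xs) ++ choose (suc m) xs

IsPartition≤ : (d : ℕ) {n : ℕ} → List (Subset n) → Set
IsPartition≤ d F =
    ListAll.All Nonempty F
  × ListAll.All (λ b → ∣ b ∣ ≤ d) F
  × AllPairs (λ b c → Empty (b ∩ c)) F
  × (∀ i → ListAny.Any (i ∈_) F)

isPartition≤? : (d : ℕ) {n : ℕ} (F : List (Subset n)) → Dec (IsPartition≤ d F)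
isPartition≤? d F =
        ListAll.all? nonempty? F
  ×-dec ListAll.all? (λ b → ∣ b ∣ ≤? d) F
  ×-dec allPairs? (λ b c → ¬? (nonempty? (b ∩ c))) F
  ×-dec all? (λ i → ListAny.any? (i ∈?_) F)

-- S≤ d n m is the restricted Stirling number of the second kind: among the
-- m-element sets of subsets of Fin n, count the partitions with blocks of size ≤ d.
S≤ : ℕ → ℕ → ℕ → ℕ
S≤ d n m = length (filter (isPartition≤? d) (choose m (subsets n)))

{-# OPTIONS --safe #-}
-- Swapping a 2 × 2 permutation submatrix preserves the row and column sums, so the rows
-- of a lonesum matrix form a chain under inclusion.  If there are no zero rows and columns
-- and m distinct rows, the matrix is the staircase A i j = 1 ⇔ f i ≤ g j for unique
-- surjections f, g from the rows and from the columns onto {0, …, m − 1}, whose fibres are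
-- the classes of equal rows and of equal columns.  Conversely every staircase is lonesum.
-- A surjection onto {0, …, m − 1} with fibres of size at most d is an ordered partition
-- into m blocks of size at most d, and there are m ! * S≤ of those.
module Submission where

open import Defs

open import Data.Bool using (Bool; true; false; not; _∧_; _∨_; if_then_else_)
import Data.Bool.Properties as Bool
open import Data.Fin using (Fin; zero; suc; toℕ; fromℕ<; punchOut)
import Data.Fin.Properties as Fin
open import Data.Fin.Subset
  using (Subset; inside; outside; Nonempty; Empty; _∈_; _∉_; _⊆_; _∩_; ∣_∣)
open import Data.Fin.Subset.Properties
  using (_∈?_; _⊆?_; ⊆-antisym; ⊆-refl; ⊆-trans; x∈p∩q⁺; x∈p∩q⁻; ∩-comm; nonempty?;
    Empty-unique)
open import Data.List as List
  using (List; []; _∷_; [_]; _++_; length; filter; concatMap; map; sum; upTo; applyUpTo;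
    deduplicate; cartesianProduct)
open import Data.List.Properties
  using (length-++; length-map; length-filter; length-applyUpTo; filter-++; filter-all;
    filter-none; filter-notAll; map-cong; ∷-injectiveˡ; ∷-injectiveʳ)
open import Data.List.Membership.Propositional
  using (find; lose) renaming (_∈_ to _∈ˡ_; _∉_ to _∉ˡ_)
open import Data.List.Membership.Propositional.Properties
  using (∈-++⁺ʳ; ∈-++⁺ˡ; ∈-++⁻; ∈-applyUpTo⁺; ∈-cartesianProduct⁺; ∈-cartesianProduct⁻;
    ∈-concatMap⁺; ∈-concatMap⁻; ∈-deduplicate⁺; ∈-deduplicate⁻; ∈-filter⁺; ∈-filter⁻; ∈-lookup;
    ∈-map⁺; ∈-map⁻; ∈-tabulate⁺; ∈-tabulate⁻; ∈-upTo⁺; ∈-∃++)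
import Data.List.Membership.DecPropositional as DecMembership
open import Data.List.Relation.Binary.Permutation.Propositional using (_↭_; ↭-sym; prep; ↭⇒↭ₛ)
open import Data.List.Relation.Binary.Permutation.Propositional.Properties
  using (shift; ↭-length; All-resp-↭; Any-resp-↭)
import Data.List.Relation.Binary.Permutation.Setoid.Properties as Permutation
open import Data.List.Relation.Unary.All as All using (All; []; _∷_)
import Data.List.Relation.Unary.All.Properties as All
open import Data.List.Relation.Unary.AllPairs as AllPairs using (AllPairs; []; _∷_)
import Data.List.Relation.Unary.AllPairs.Properties as AllPairs
open import Data.List.Relation.Unary.Any using (Any; here; there)
open import Data.List.Relation.Unary.Unique.DecPropositional.Properties using (deduplicate-!)
open import Data.List.Relation.Unary.Unique.Propositional using (Unique)
import Data.List.Relation.Unary.Unique.Propositional.Properties as Unique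
open import Data.Nat
  using (ℕ; zero; suc; pred; _+_; _*_; _⊓_; _!; _≡ᵇ_; _≤ᵇ_; _≤_; _<_; _≥_; z≤n; s≤s; z<s; s<s;
    s≤s⁻¹)
open import Data.Nat.Properties
  using (*-assoc; *-comm; *-distribˡ-+; *-identityʳ; *-identityˡ; *-monoʳ-≤; *-suc; *-zeroʳ;
    +-*-semiring; +-cancelʳ-≡; +-cancelʳ-≤; +-cancelˡ-≡; +-comm; +-identityʳ; +-mono-≤; +-monoʳ-≤;
    1+n≰n; <-irrefl; <-trans; <⇒≢; <⇒≤; <⇒≱; m≤n⇒m<n∨m≡n; m≤n⇒m≤1+n; n<1+n; suc-injective; ≡ᵇ⇒≡;
    ≡⇒≡ᵇ; ≤-<-trans; ≤-antisym; ≤-refl; ≤-reflexive; ≤-trans; ≤ᵇ⇒≤; ≤⇒≤ᵇ; ≮⇒≥; ≰⇒>; ⊓-glb)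
open import Data.Product using (∃; ∃₂; _×_; _,_; proj₁; proj₂)
open import Data.Sum using (_⊎_; inj₁; inj₂)
open import Data.Vec as Vec using (Vec; []; _∷_; count; lookup; tabulate; transpose)
open import Data.Vec.Properties
  using (≡-dec; lookup∘tabulate; tabulate∘lookup; tabulate-cong; []=⇒lookup; lookup⇒[]=;
    lookup-map; lookup-⊛; lookup-replicate) renaming (∷-injectiveʳ to ∷ᵛ-injectiveʳ)
import Data.Vec.Relation.Unary.All.Properties as VecAll
open import Function using (_∘_; flip; mk⇔; Equivalence; Injective)
open import Relation.Binary.Definitions using (DecidableEquality; _Respects_)
open import Relation.Binary.PropositionalEquality
  using (_≡_; _≢_; _≗_; refl; sym; trans; cong; cong₂; subst; subst₂; setoid; resp₂)
open import Relation.Nullary using (¬_; yes; no; contradiction; does; ¬?)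
open import Relation.Nullary.Decidable using (_×-dec_)
open import Relation.Unary using (Decidable)

open import Algebra.Properties.Semiring.Sum +-*-semiring
  using (∑-comm; ∑-distrib-+; sum-cong-≗; sum-replicate-zero; *-distribˡ-sum; *-distribʳ-sum)
    renaming (sum to ∑)

-- Why both partitions have the same number of blocks: the row types that contain a fixed column
-- form an up-set of the chain of types. Without zero columns only the `m` nonempty up-sets can
-- occur, and all of them do: neighbouring types differ in some column, and the smallest type is
-- nonempty because there are no zero rows. Row levels descend while column levels ascend: level 0
-- is the fullest row type but the sparsest column type. A matrix fixes the order of its blocks,
-- whereas `choose` lists each family of blocks in one order only, inherited from `subsets`.
-- Counting therefore goes through `arrangements`, which lists every order, and the factor `m !`
-- becomes a statement about lists and permutation-invariant predicates, separate from matrices.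

private variable
  A B : Set
  x : A
  xs ys zs bs es : List A
  a d k m n : ℕ
  X Y : List (Subset n)


-- Ordered selections from a list

-- The conditions are restricted to members of `xs` because insertion is duplicate-free and
-- injective only on lists that avoid the inserted element.
concatMap-unique : {f : A → List B} → (∀ {x} → x ∈ˡ xs → Unique (f x)) →
  (∀ {x y z} → x ∈ˡ xs → y ∈ˡ xs → z ∈ˡ f x → z ∈ˡ f y → x ≡ y) →
  Unique xs → Unique (concatMap f xs)
concatMap-unique {xs = []} _ _ _ = []
concatMap-unique {xs = x ∷ xs} {f} f! disj (x∉xs ∷ xs!) =
  Unique.++⁺ (f! (here refl))
    (concatMap-unique (f! ∘ there) (λ p q → disj (there p) (there q)) xs!)
    λ (z∈fx , z∈rest) → case (find (∈-concatMap⁻ f {xs = xs} z∈rest)) z∈fx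
  where
  case : ∀ {z} → (∃ λ y → y ∈ˡ xs × z ∈ˡ f y) → ¬ (z ∈ˡ f x)
  case (y , y∈xs , z∈fy) z∈fx = All.lookup x∉xs y∈xs (disj (here refl) (there y∈xs) z∈fx z∈fy)

insertions : A → List A → List (List A)
insertions x []       = [ [ x ] ]
insertions x (y ∷ ys) = (x ∷ y ∷ ys) ∷ map (y ∷_) (insertions x ys)

length-insertions : ∀ (x : A) ys → length (insertions x ys) ≡ suc (length ys)
length-insertions x []       = refl
length-insertions x (y ∷ ys) =
  cong suc (trans (length-map (y ∷_) (insertions x ys)) (length-insertions x ys))

∈-insertions⁺ : ∀ as {bs} → as ++ x ∷ bs ∈ˡ insertions x (as ++ bs)
∈-insertions⁺ [] {[]}    = here refl
∈-insertions⁺ [] {_ ∷ _} = here refl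
∈-insertions⁺ (a ∷ as)   = there (∈-map⁺ (a ∷_) (∈-insertions⁺ as))

∈-insertions⁻ : ∀ ys → zs ∈ˡ insertions x ys →
  ∃₂ λ as bs → ys ≡ as ++ bs × zs ≡ as ++ x ∷ bs
∈-insertions⁻ []       (here refl) = [] , [] , refl , refl
∈-insertions⁻ (y ∷ ys) (here refl) = [] , y ∷ ys , refl , refl
∈-insertions⁻ (y ∷ ys) (there p) with ∈-map⁻ (y ∷_) p
... | _ , q , refl with ∈-insertions⁻ ys q
... | as , bs , refl , refl = y ∷ as , bs , refl , refl

∈-insertions⇒↭ : zs ∈ˡ insertions x ys → zs ↭ x ∷ ys
∈-insertions⇒↭ {ys = ys} p with ∈-insertions⁻ ys p
... | as , bs , refl , refl = shift _ as bs

insertions-unique : x ∉ˡ ys → Unique (insertions x ys)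
insertions-unique {ys = []}     _ = [] ∷ []
insertions-unique {ys = y ∷ ys} x∉ =
  All.map⁺ (All.tabulate λ _ eq → x∉ (here (∷-injectiveˡ eq))) ∷
  Unique.map⁺ ∷-injectiveʳ (insertions-unique (x∉ ∘ there))

-- Absence of `x` from both prefixes makes each of them the part before the first occurrence of `x`.
split-unique : ∀ as cs → x ∉ˡ as → x ∉ˡ cs → as ++ x ∷ bs ≡ cs ++ x ∷ es →
  as ++ bs ≡ cs ++ es
split-unique []       []       _  _  eq = ∷-injectiveʳ eq
split-unique []       (c ∷ cs) _  x∉ eq = contradiction (here (∷-injectiveˡ eq)) x∉
split-unique (a ∷ as) []       x∉ _  eq = contradiction (here (sym (∷-injectiveˡ eq))) x∉
split-unique (a ∷ as) (c ∷ cs) x∉as x∉cs eq =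
  cong₂ _∷_ (∷-injectiveˡ eq) (split-unique as cs (x∉as ∘ there) (x∉cs ∘ there) (∷-injectiveʳ eq))

insertions-injective : x ∉ˡ xs → x ∉ˡ ys → zs ∈ˡ insertions x xs → zs ∈ˡ insertions x ys → xs ≡ ys
insertions-injective {xs = xs} {ys = ys} x∉xs x∉ys p q with ∈-insertions⁻ xs p | ∈-insertions⁻ ys q
... | as , bs , refl , refl | cs , es , refl , eq =
  split-unique as cs (x∉xs ∘ ∈-++⁺ˡ) (x∉ys ∘ ∈-++⁺ˡ) eq

-- The ordered counterpart of `choose`.
arrangements : ℕ → List A → List (List A)
arrangements zero    _        = [ [] ]
arrangements (suc m) []       = []
arrangements (suc m) (x ∷ xs) =
  concatMap (insertions x) (arrangements m xs) ++ arrangements (suc m) xs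

module _ {P : List A → Set} (P? : Decidable P) where

  length-filter-map : (f : B → List A) → ∀ xs →
    length (filter P? (map f xs)) ≡ length (filter (P? ∘ f) xs)
  length-filter-map f [] = refl
  length-filter-map f (x ∷ xs) with P? (f x)
  ... | yes _ = cong suc (length-filter-map f xs)
  ... | no  _ = length-filter-map f xs

∈-arrangements-cons⁻ : ∀ m {x : A} xs → zs ∈ˡ concatMap (insertions x) (arrangements m xs) →
  ∃ λ ys → ys ∈ˡ arrangements m xs × zs ∈ˡ insertions x ys
∈-arrangements-cons⁻ m {x} xs = find ∘ ∈-concatMap⁻ (insertions x) {xs = arrangements m xs}

∈-arrangements⇒length : ∀ m (xs : List A) → zs ∈ˡ arrangements m xs → length zs ≡ m
∈-arrangements⇒length zero    xs (here refl) = refl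
∈-arrangements⇒length (suc m) (x ∷ xs) p with ∈-++⁻ (concatMap (insertions x) (arrangements m xs)) p
... | inj₂ q = ∈-arrangements⇒length (suc m) xs q
... | inj₁ q with ∈-arrangements-cons⁻ m xs q
... | ys , ys∈ , zs∈ = trans (↭-length (∈-insertions⇒↭ zs∈)) (cong suc (∈-arrangements⇒length m xs ys∈))

∈-arrangements⇒⊆ : ∀ m (xs : List A) → zs ∈ˡ arrangements m xs → x ∈ˡ zs → x ∈ˡ xs
∈-arrangements⇒⊆ zero    xs (here refl) ()
∈-arrangements⇒⊆ (suc m) (x ∷ xs) p z∈ with ∈-++⁻ (concatMap (insertions x) (arrangements m xs)) p
... | inj₂ q = there (∈-arrangements⇒⊆ (suc m) xs q z∈)
... | inj₁ q with ∈-arrangements-cons⁻ m xs q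
... | ys , ys∈ , zs∈ with ∈-insertions⁻ ys zs∈
... | as , bs , refl , refl with ∈-++⁻ as z∈
... | inj₁ z∈as         = there (∈-arrangements⇒⊆ m xs ys∈ (∈-++⁺ˡ z∈as))
... | inj₂ (here eq)    = here eq
... | inj₂ (there z∈bs) = there (∈-arrangements⇒⊆ m xs ys∈ (∈-++⁺ʳ as z∈bs))

arrangements-unique : ∀ m {xs : List A} → Unique xs → Unique (arrangements m xs)
arrangements-unique zero    _ = [] ∷ []
arrangements-unique (suc m) {[]} _ = []
arrangements-unique (suc m) {x ∷ xs} x∷xs!@(_ ∷ xs!) = Unique.++⁺
  (concatMap-unique (insertions-unique ∘ x∉ m) (λ p q → insertions-injective (x∉ m p) (x∉ m q))
    (arrangements-unique m xs!))
  (arrangements-unique (suc m) xs!)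
  λ (p , q) → disj (∈-arrangements-cons⁻ m xs p) q
  where
  x∉xs = Unique.Unique[x∷xs]⇒x∉xs x∷xs!
  x∉ : ∀ l {zs} → zs ∈ˡ arrangements l xs → x ∉ˡ zs
  x∉ l p = x∉xs ∘ ∈-arrangements⇒⊆ l xs p
  disj : (∃ λ ys → ys ∈ˡ arrangements m xs × zs ∈ˡ insertions x ys) → zs ∉ˡ arrangements (suc m) xs
  disj (ys , _ , zs∈) q with ∈-insertions⁻ ys zs∈
  ... | as , bs , refl , refl = x∉ (suc m) q (∈-++⁺ʳ as (here refl))

module _ (_≟_ : DecidableEquality A) where
  open DecMembership _≟_ using () renaming (_∈?_ to _∈ˡ?_)

  -- Recursion on the pool: if its head `x` occurs in `zs`, it is deleted there and recovered by an
  -- insertion; otherwise `zs` is drawn from the tail.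
  ∈-arrangements⁺ : ∀ {m} xs {zs : List A} → length zs ≡ m → Unique zs →
    (∀ {z} → z ∈ˡ zs → z ∈ˡ xs) → zs ∈ˡ arrangements m xs
  ∈-arrangements⁺ xs       {[]}     refl _   _  = here refl
  ∈-arrangements⁺ []       {z ∷ zs} refl _   zs⊆ with () ← zs⊆ (here refl)
  ∈-arrangements⁺ (x ∷ xs) {zs@(_ ∷ zs′)} refl zs! zs⊆ with x ∈ˡ? zs
  ... | no  x∉zs = ∈-++⁺ʳ (concatMap (insertions x) (arrangements (length zs′) xs))
      (∈-arrangements⁺ xs refl zs! λ z∈ → shrink z∈ (zs⊆ z∈))
    where
    shrink : ∀ {z} → z ∈ˡ zs → z ∈ˡ x ∷ xs → z ∈ˡ xs
    shrink z∈ (here refl) = contradiction z∈ x∉zs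
    shrink _  (there p)   = p
  ... | yes x∈zs with ∈-∃++ x∈zs
  ... | as , bs , eq = ∈-++⁺ˡ (∈-concatMap⁺ (insertions x)
    (lose as++bs∈ (subst (_∈ˡ insertions x (as ++ bs)) (sym eq) (∈-insertions⁺ as))))
    where
    -- Moving `x` to the front turns uniqueness of `zs` into absence of `x` from the rest, so the
    -- rest is drawn from `xs` alone.
    x∷as++bs! : Unique (x ∷ as ++ bs)
    x∷as++bs! = Permutation.AllPairs-resp-↭ (setoid _) (_∘ sym) (resp₂ _≢_)
      (↭⇒↭ₛ (shift x as bs)) (subst Unique eq zs!)
    x∉ = Unique.Unique[x∷xs]⇒x∉xs x∷as++bs!
    shrink : ∀ {z} → z ∈ˡ as ++ bs → z ∈ˡ x ∷ xs → z ∈ˡ xs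
    shrink z∈ (here refl) = contradiction z∈ x∉
    shrink _  (there p)   = p
    grow : ∀ {z} → z ∈ˡ as ++ bs → z ∈ˡ as ++ x ∷ bs
    grow p with ∈-++⁻ as p
    ... | inj₁ q = ∈-++⁺ˡ q
    ... | inj₂ q = ∈-++⁺ʳ as (there q)
    as++bs∈ : as ++ bs ∈ˡ arrangements (length zs′) xs
    as++bs∈ = ∈-arrangements⁺ xs
      (suc-injective (trans (sym (↭-length (shift x as bs))) (cong length (sym eq))))
      (AllPairs.tail x∷as++bs!)
      λ z∈ → shrink z∈ (zs⊆ (subst (_ ∈ˡ_) (sym eq) (grow z∈)))

module _ {P : List A → Set} (P? : Decidable P) (P-resp : P Respects _↭_) where

  -- All `suc m` insertions of `x` into `ys` are permutations of `x ∷ ys`, so `P` holds for all of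
  -- them or for none.
  length-filter-insertions : ∀ {m} x {yss} → All (λ ys → length ys ≡ m) yss →
    length (filter P? (concatMap (insertions x) yss)) ≡ suc m * length (filter (P? ∘ (x ∷_)) yss)
  length-filter-insertions {m} x [] = sym (*-zeroʳ (suc m))
  length-filter-insertions {m} x {ys ∷ yss} (refl ∷ ls)
    rewrite filter-++ P? (insertions x ys) (concatMap (insertions x) yss)
          | length-++ (filter P? (insertions x ys)) {filter P? (concatMap (insertions x) yss)}
          | length-filter-insertions x ls with P? (x ∷ ys)
  ... | no ¬p = cong (λ l → length l + rest)
    (filter-none P? (All.tabulate λ zs∈ → ¬p ∘ P-resp (∈-insertions⇒↭ zs∈)))
    where rest = suc m * length (filter (P? ∘ (x ∷_)) yss)
  ... | yes p = trans
    (cong (_+ suc m * rest) (trans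
      (cong length (filter-all P? (All.tabulate λ zs∈ → P-resp (↭-sym (∈-insertions⇒↭ zs∈)) p)))
      (length-insertions x ys)))
    (sym (*-suc (suc m) rest))
    where rest = length (filter (P? ∘ (x ∷_)) yss)

-- Induction along the recursion that `choose` and `arrangements` share. The branch that uses `x`
-- applies the hypothesis to `P? ∘ (x ∷_)`, hence the generality over all permutation-invariant
-- predicates.
length-filter-arrangements : {P : List A → Set} (P? : Decidable P) → P Respects _↭_ → ∀ m xs →
  length (filter P? (arrangements m xs)) ≡ m ! * length (filter P? (choose m xs))
length-filter-arrangements P? P-resp zero xs = sym (*-identityˡ _)
length-filter-arrangements P? P-resp (suc m) [] = sym (*-zeroʳ (suc m !))
length-filter-arrangements P? P-resp (suc m) (x ∷ xs)
  rewrite filter-++ P? (concatMap (insertions x) (arrangements m xs)) (arrangements (suc m) xs)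
        | length-++ (filter P? (concatMap (insertions x) (arrangements m xs)))
            {filter P? (arrangements (suc m) xs)}
        | filter-++ P? (map (x ∷_) (choose m xs)) (choose (suc m) xs)
        | length-++ (filter P? (map (x ∷_) (choose m xs))) {filter P? (choose (suc m) xs)}
        | length-filter-map P? (x ∷_) (choose m xs)
        | length-filter-insertions P? P-resp x (All.tabulate (∈-arrangements⇒length m xs))
        | length-filter-arrangements (P? ∘ (x ∷_)) (P-resp ∘ prep x) m xs
        | length-filter-arrangements P? P-resp (suc m) xs
        | *-distribˡ-+ (suc m !) (length (filter (P? ∘ (x ∷_)) (choose m xs)))
            (length (filter P? (choose (suc m) xs)))
        | *-assoc (suc m) (m !) (length (filter (P? ∘ (x ∷_)) (choose m xs)))
  = refl

-- Ordered partitions and level functions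

subsets-unique : ∀ n → Unique (subsets n)
subsets-unique zero    = [] ∷ []
subsets-unique (suc n) = Unique.++⁺
  (Unique.map⁺ ∷ᵛ-injectiveʳ (subsets-unique n))
  (Unique.map⁺ ∷ᵛ-injectiveʳ (subsets-unique n))
  λ (p , q) → disj (∈-map⁻ (inside ∷_) p) (∈-map⁻ (outside ∷_) q)
  where
  disj : ∀ {s} → (∃ λ t → t ∈ˡ subsets n × s ≡ inside ∷ t) →
    ¬ (∃ λ t → t ∈ˡ subsets n × s ≡ outside ∷ t)
  disj (_ , _ , refl) (_ , _ , ())

∈-subsets : ∀ (s : Subset n) → s ∈ˡ subsets n
∈-subsets []            = here refl
∈-subsets (inside  ∷ s) = ∈-++⁺ˡ (∈-map⁺ (inside ∷_) (∈-subsets s))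
∈-subsets {suc n} (outside ∷ s) =
  ∈-++⁺ʳ (map (inside ∷_) (subsets n)) (∈-map⁺ (outside ∷_) (∈-subsets s))

IsPartition≤-resp-↭ : IsPartition≤ d {n} Respects _↭_
IsPartition≤-resp-↭ p (ne , sm , dj , cv) =
  All-resp-↭ p ne , All-resp-↭ p sm ,
  Permutation.AllPairs-resp-↭ (setoid _)
    (λ {b} {c} → subst Empty (∩-comm b c)) (resp₂ _) (↭⇒↭ₛ p) dj ,
  λ i → Any-resp-↭ p (cv i)

-- A nonempty block is not disjoint from itself, so it cannot occur twice. Hence no ordered
-- partition is missing among the `arrangements` of `subsets n`.
IsPartition≤⇒Unique : IsPartition≤ d X → Unique X
IsPartition≤⇒Unique (ne , _ , dj , _) = go ne dj
  where
  go : All Nonempty X → AllPairs (λ b c → Empty (b ∩ c)) X → Unique X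
  go [] [] = []
  go ((i , i∈x) ∷ ne) (dj ∷ djs) =
    All.map (λ x∩y≡∅ → λ { refl → x∩y≡∅ (i , x∈p∩q⁺ (i∈x , i∈x)) }) dj ∷ go ne djs

orderedPartitions : (d n m : ℕ) → List (List (Subset n))
orderedPartitions d n m = filter (isPartition≤? d) (arrangements m (subsets n))

orderedPartitions-unique : ∀ d n m → Unique (orderedPartitions d n m)
orderedPartitions-unique d n m =
  Unique.filter⁺ (isPartition≤? d) (arrangements-unique m (subsets-unique n))

∈-orderedPartitions⁺ : IsPartition≤ d {n} X → length X ≡ m → X ∈ˡ orderedPartitions d n m
∈-orderedPartitions⁺ {d} {n} p l = ∈-filter⁺ (isPartition≤? d)
  (∈-arrangements⁺ (≡-dec Bool._≟_) (subsets n) l (IsPartition≤⇒Unique p) λ {s} _ → ∈-subsets s) p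

∈-orderedPartitions⁻ : X ∈ˡ orderedPartitions d n m → IsPartition≤ d X × length X ≡ m
∈-orderedPartitions⁻ {n} {d = d} {m} X∈ with ∈-filter⁻ (isPartition≤? d) {xs = arrangements m (subsets n)} X∈
... | X∈′ , p = p , ∈-arrangements⇒length m (subsets n) X∈′

length-orderedPartitions : ∀ d n m → length (orderedPartitions d n m) ≡ m ! * S≤ d n m
length-orderedPartitions d n m =
  length-filter-arrangements (isPartition≤? d) IsPartition≤-resp-↭ m (subsets n)

-- Junk value: level X i = length X if no block contains i.
level : List (Subset n) → Fin n → ℕ
level []      i = zero
level (x ∷ X) i with i ∈? x
... | yes _ = zero
... | no  _ = suc (level X i)

fiber : (Fin n → ℕ) → ℕ → Subset n
fiber f a = Vec.tabulate λ i → f i ≡ᵇ a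

fiber-cong : ∀ {f g : Fin n → ℕ} → f ≗ g → fiber f a ≡ fiber g a
fiber-cong {a = a} f≗g = tabulate-cong λ i → cong (_≡ᵇ a) (f≗g i)

∈-fiber⁺ : ∀ (f : Fin n → ℕ) {i} → f i ≡ a → i ∈ fiber f a
∈-fiber⁺ {a = a} f {i} eq = lookup⇒[]= i _
  (trans (lookup∘tabulate _ i) (Equivalence.to Bool.T-≡ (≡⇒≡ᵇ (f i) a eq)))

∈-fiber⁻ : ∀ (f : Fin n → ℕ) {i} → i ∈ fiber f a → f i ≡ a
∈-fiber⁻ {a = a} f {i} i∈ = ≡ᵇ⇒≡ (f i) a
  (Equivalence.from Bool.T-≡ (trans (sym (lookup∘tabulate _ i)) ([]=⇒lookup i∈)))

-- The values lie in `ℕ`, not in `Fin m`: when two staircases of one matrix are compared, `m ≡ m′`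
-- is itself a conclusion, and the level functions can be compared without transport.
record IsLevelling (d m : ℕ) {n : ℕ} (f : Fin n → ℕ) : Set where
  field
    bounded : ∀ i → f i < m
    onto    : a < m → ∃ λ i → f i ≡ a
    small   : a < m → ∣ fiber f a ∣ ≤ d

level<length : ∀ {i} → Any (i ∈_) X → level X i < length X
level<length {X = x ∷ X} {i} i∈ with i ∈? x | i∈
... | yes _  | _          = z<s
... | no i∉x | here i∈x   = contradiction i∈x i∉x
... | no _   | there i∈X  = s<s (level<length i∈X)

∈-lookup-level : ∀ (X : List (Subset n)) {i} (c : Fin (length X)) →
  level X i ≡ toℕ c → i ∈ List.lookup X c
∈-lookup-level (x ∷ X) {i} c eq with i ∈? x | c
... | yes i∈x | zero  = i∈x
... | no _    | suc c = ∈-lookup-level X c (suc-injective eq)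

-- `level` finds the first block containing `i`; disjointness makes it the only one.
level-∈-lookup : AllPairs (λ b c → Empty (b ∩ c)) X → ∀ {i} (c : Fin (length X)) →
  i ∈ List.lookup X c → level X i ≡ toℕ c
level-∈-lookup {X = x ∷ X} (dj ∷ djs) {i} c i∈ with i ∈? x | c
... | yes _   | zero  = refl
... | no i∉x  | zero  = contradiction i∈ i∉x
... | yes i∈x | suc c = contradiction (i , x∈p∩q⁺ (i∈x , i∈)) (All.lookup dj (∈-lookup c))
... | no _    | suc c = cong suc (level-∈-lookup djs c i∈)

lookup≡fiber-level : AllPairs (λ b c → Empty (b ∩ c)) X →
  ∀ c → List.lookup X c ≡ fiber (level X) (toℕ c)
lookup≡fiber-level {X = X} dj c = ⊆-antisym
  (λ i∈ → ∈-fiber⁺ (level X) (level-∈-lookup dj c i∈))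
  (λ i∈ → ∈-lookup-level X c (∈-fiber⁻ (level X) i∈))

blocks : (Fin n → ℕ) → ℕ → List (Subset n)
blocks f = applyUpTo (fiber f)

applyUpTo-lookup : ∀ {A : Set} (h : ℕ → A) xs → (∀ c → List.lookup xs c ≡ h (toℕ c)) →
  xs ≡ applyUpTo h (length xs)
applyUpTo-lookup h []       _  = refl
applyUpTo-lookup h (x ∷ xs) eq = cong₂ _∷_ (eq zero) (applyUpTo-lookup (h ∘ suc) xs (eq ∘ suc))

-- Each list is recovered from its level function as the fibres in increasing order, and its length
-- tells how many fibres to take.
level-injective : IsPartition≤ d X → IsPartition≤ d Y → length X ≡ length Y →
  level X ≗ level Y → X ≡ Y
level-injective {X = X} {Y = Y} (_ , _ , djX , _) (_ , _ , djY , _) lX≡lY eq = trans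
  (applyUpTo-lookup _ X λ c → trans (lookup≡fiber-level djX c) (fiber-cong eq))
  (trans (cong (blocks (level Y)) lX≡lY) (sym (applyUpTo-lookup _ Y (lookup≡fiber-level djY))))

level-isLevelling : IsPartition≤ d X → IsLevelling d (length X) (level X)
level-isLevelling {d = d} {X = X} (ne , sm , dj , cv) = record
  { bounded = λ i → level<length (cv i)
  ; onto    = onto
  ; small   = λ a<m → subst (λ s → ∣ s ∣ ≤ d) (lookup-fromℕ< a<m) (All.lookup sm (∈-lookup (fromℕ< a<m)))
  }
  where
  lookup-fromℕ< : (a<m : a < length X) → List.lookup X (fromℕ< a<m) ≡ fiber (level X) a
  lookup-fromℕ< a<m = trans (lookup≡fiber-level dj _) (cong (fiber (level X)) (Fin.toℕ-fromℕ< a<m))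
  onto : a < length X → ∃ λ i → level X i ≡ a
  onto a<m with All.lookup ne (∈-lookup (fromℕ< a<m))
  ... | i , i∈ = i , ∈-fiber⁻ (level X) (subst (i ∈_) (lookup-fromℕ< a<m) i∈)

blocks-isPartition : ∀ {f : Fin n → ℕ} → IsLevelling d m f → IsPartition≤ d (blocks f m)
blocks-isPartition {m = m} {f} lv =
  All.applyUpTo⁺₁ (fiber f) m (λ a<m → let i , eq = onto a<m in i , ∈-fiber⁺ f eq) ,
  All.applyUpTo⁺₁ (fiber f) m small ,
  AllPairs.applyUpTo⁺₁ (fiber f) m (λ {a} {b} a<b _ (i , i∈) →
    let i∈a , i∈b = x∈p∩q⁻ (fiber f a) (fiber f b) i∈ in
    <⇒≢ a<b (trans (sym (∈-fiber⁻ f i∈a)) (∈-fiber⁻ f i∈b))) ,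
  λ i → lose (∈-applyUpTo⁺ (fiber f) (bounded i)) (∈-fiber⁺ f refl)
  where open IsLevelling lv

-- Stated for an arbitrary family `h`, since the recursion passes to `h ∘ suc`.
level-applyUpTo : ∀ (h : ℕ → Subset n) {c m i} → c < m → i ∈ h c → (∀ {a} → i ∈ h a → a ≡ c) →
  level (applyUpTo h m) i ≡ c
level-applyUpTo h {c} {suc m} {i} c<m i∈ only with i ∈? h zero
... | yes i∈h0 = only i∈h0
level-applyUpTo h {zero}  {suc m} c<m i∈ only | no i∉h0 = contradiction i∈ i∉h0
level-applyUpTo h {suc c} {suc m} (s<s c<m) i∈ only | no i∉h0 =
  cong suc (level-applyUpTo (h ∘ suc) c<m i∈ (suc-injective ∘ only))

level-blocks : ∀ {f : Fin n → ℕ} → IsLevelling d m f → ∀ i → level (blocks f m) i ≡ f i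
level-blocks {f = f} lv i =
  level-applyUpTo (fiber f) (IsLevelling.bounded lv i) (∈-fiber⁺ f refl) (sym ∘ ∈-fiber⁻ f)

-- Row and column sums, lonesum matrices

at : Matrix n k → Fin n → Fin k → Bool
at A i j = lookup (lookup A i) j

lookup-ext : ∀ {A : Set} {xs ys : Vec A n} → lookup xs ≗ lookup ys → xs ≡ ys
lookup-ext {xs = xs} {ys} eq =
  trans (sym (tabulate∘lookup xs)) (trans (tabulate-cong eq) (tabulate∘lookup ys))

at-ext : {A B : Matrix n k} → (∀ i j → at A i j ≡ at B i j) → A ≡ B
at-ext eq = lookup-ext λ i → lookup-ext (eq i)

fromEntries : (Fin n → Fin k → Bool) → Matrix n k
fromEntries a = tabulate λ i → tabulate (a i)

at-fromEntries : ∀ (a : Fin n → Fin k → Bool) i j → at (fromEntries a) i j ≡ a i j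
at-fromEntries a i j =
  trans (cong (λ r → lookup r j) (lookup∘tabulate _ i)) (lookup∘tabulate (a i) j)

at-transpose : ∀ (A : Matrix n k) i j → at (transpose A) j i ≡ at A i j
at-transpose {k = k} (r ∷ A) i j = trans (cong (flip lookup i) column) (by-row i)
  where
  column : lookup (transpose (r ∷ A)) j ≡ lookup r j ∷ lookup (transpose A) j
  column = trans (lookup-⊛ j (Vec.replicate k Vec._∷_ Vec.⊛ r) (transpose A))
    (cong (λ h → h (lookup (transpose A) j)) (trans (lookup-⊛ j (Vec.replicate k Vec._∷_) r)
      (cong (λ h → h (lookup r j)) (lookup-replicate j Vec._∷_))))
  by-row : ∀ i → lookup (lookup r j ∷ lookup (transpose A) j) i ≡ at (r ∷ A) i j
  by-row zero    = refl
  by-row (suc i) = at-transpose A i j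

sum-map-entry : (r : Vec Bool k) → Vec.sum (Vec.map entry r) ≡ ∑ (entry ∘ lookup r)
sum-map-entry []      = refl
sum-map-entry (x ∷ r) = cong (entry x +_) (sum-map-entry r)

lookup-rowSums : ∀ (A : Matrix n k) i → lookup (rowSums A) i ≡ ∑ (entry ∘ at A i)
lookup-rowSums A i = trans (lookup-map i _ A) (sum-map-entry (lookup A i))

lookup-columnSums : ∀ (A : Matrix n k) j → lookup (columnSums A) j ≡ ∑ (λ i → entry (at A i j))
lookup-columnSums A j = trans (lookup-rowSums (transpose A) j)
  (sum-cong-≗ λ i → cong entry (at-transpose A i j))

module _ (A B : Matrix n k) where

  rowSums-≡⁺ : (∀ i → ∑ (entry ∘ at A i) ≡ ∑ (entry ∘ at B i)) → rowSums A ≡ rowSums B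
  rowSums-≡⁺ eq = lookup-ext λ i →
    trans (lookup-rowSums A i) (trans (eq i) (sym (lookup-rowSums B i)))

  rowSums-≡⁻ : rowSums A ≡ rowSums B → ∀ i → ∑ (entry ∘ at A i) ≡ ∑ (entry ∘ at B i)
  rowSums-≡⁻ eq i =
    trans (sym (lookup-rowSums A i)) (trans (cong (flip lookup i) eq) (lookup-rowSums B i))

  columnSums-≡⁺ : (∀ j → ∑ (λ i → entry (at A i j)) ≡ ∑ (λ i → entry (at B i j))) →
    columnSums A ≡ columnSums B
  columnSums-≡⁺ eq = lookup-ext λ j →
    trans (lookup-columnSums A j) (trans (eq j) (sym (lookup-columnSums B j)))

  columnSums-≡⁻ : columnSums A ≡ columnSums B →
    ∀ j → ∑ (λ i → entry (at A i j)) ≡ ∑ (λ i → entry (at B i j))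
  columnSums-≡⁻ eq j =
    trans (sym (lookup-columnSums A j)) (trans (cong (flip lookup j) eq) (lookup-columnSums B j))

sum-mono-≤ : ∀ {n} {u v : Fin n → ℕ} → (∀ i → u i ≤ v i) → ∑ u ≤ ∑ v
sum-mono-≤ {zero}  _   = z≤n
sum-mono-≤ {suc n} u≤v = +-mono-≤ (u≤v zero) (sum-mono-≤ (u≤v ∘ suc))

+-≤-≡ : ∀ {a b c e} → a ≤ b → c ≤ e → a + c ≡ b + e → a ≡ b × c ≡ e
+-≤-≡ {a} {b} {c} {e} a≤b c≤e eq = a≡b , +-cancelˡ-≡ b c e (trans (cong (_+ c) (sym a≡b)) eq)
  where
  a≡b : a ≡ b
  a≡b = ≤-antisym a≤b (+-cancelʳ-≤ c b a (≤-trans (+-monoʳ-≤ b c≤e) (≤-reflexive (sym eq))))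

sum-≤-≡ : ∀ {n} {u v : Fin n → ℕ} → (∀ i → u i ≤ v i) → ∑ u ≡ ∑ v → u ≗ v
sum-≤-≡ {suc n} u≤v eq i with +-≤-≡ (u≤v zero) (sum-mono-≤ (u≤v ∘ suc)) eq | i
... | eq₀ , _   | zero  = eq₀
... | _   , eqₛ | suc i = sum-≤-≡ (u≤v ∘ suc) eqₛ i

∑-row-weights : ∀ (a b : Fin n → Fin k → ℕ) (w : Fin n → ℕ) → (∀ i → ∑ (a i) ≡ ∑ (b i)) →
  ∑ (λ i → ∑ λ j → a i j * w i) ≡ ∑ (λ i → ∑ λ j → b i j * w i)
∑-row-weights a b w eq = sum-cong-≗ λ i →
  trans (sym (*-distribʳ-sum (w i) (a i))) (trans (cong (_* w i) (eq i)) (*-distribʳ-sum (w i) (b i)))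

∑-column-weights : ∀ (a b : Fin n → Fin k → ℕ) (w : Fin k → ℕ) →
  (∀ j → ∑ (flip a j) ≡ ∑ (flip b j)) →
  ∑ (λ i → ∑ λ j → a i j * w j) ≡ ∑ (λ i → ∑ λ j → b i j * w j)
∑-column-weights a b w eq =
  trans (∑-comm (λ i j → a i j * w j))
    (trans (∑-row-weights (flip a) (flip b) w eq) (sym (∑-comm (λ i j → b i j * w j))))

∑∑-distrib-+ : ∀ (a b : Fin n → Fin k → ℕ) →
  ∑ (λ i → ∑ λ j → a i j + b i j) ≡ ∑ (λ i → ∑ (a i)) + ∑ (λ i → ∑ (b i))
∑∑-distrib-+ a b = trans (sum-cong-≗ λ i → ∑-distrib-+ (a i) (b i)) (∑-distrib-+ (∑ ∘ a) (∑ ∘ b))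

-- Staircases are lonesum

record IsStaircase (f : Fin n → ℕ) (g : Fin k → ℕ) (A : Matrix n k) : Set where
  field
    at⇒≤ : ∀ i j → at A i j ≡ true → f i ≤ g j
    ≤⇒at : ∀ i j → f i ≤ g j → at A i j ≡ true

open IsStaircase public

-- This is `(entry y - entry x) * (p - q) ≤ 0` without subtraction, where `p - q` is the weight of a
-- cell and `x` selects the cell exactly when that weight is positive.
exchange-≤ : ∀ x y {p q} → (x ≡ true → q < p) → (x ≡ false → p < q) →
  entry y * p + entry x * q ≤ entry x * p + entry y * q
exchange-≤ true  true  _   _   = ≤-refl
exchange-≤ false false _   _   = ≤-refl
exchange-≤ true  false {p} {q} q<p _ =
  subst₂ _≤_ (sym (+-identityʳ q)) (sym (trans (+-identityʳ _) (+-identityʳ p)))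
  (<⇒≤ (q<p refl))
exchange-≤ false true  {p} {q} _ p<q =
  subst₂ _≤_ (sym (trans (+-identityʳ _) (+-identityʳ p))) (sym (+-identityʳ q)) (<⇒≤ (p<q refl))

-- The two hypotheses exclude weight zero, so a `y` different from `x` would make the inequality
-- strict.
exchange-≡ : ∀ x y {p q} → (x ≡ true → q < p) → (x ≡ false → p < q) →
  entry y * p + entry x * q ≡ entry x * p + entry y * q → y ≡ x
exchange-≡ true  true  _   _   _  = refl
exchange-≡ false false _   _   _  = refl
exchange-≡ true  false {p} {q} q<p _ eq =
  contradiction (trans (sym (+-identityʳ q)) (trans eq (trans (+-identityʳ _) (+-identityʳ p))))
    (<⇒≢ (q<p refl))
exchange-≡ false true  {p} {q} _ p<q eq =
  contradiction (trans (sym (trans (+-identityʳ _) (+-identityʳ p))) (trans eq (+-identityʳ q)))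
    (<⇒≢ (p<q refl))

-- Give cell (i , j) the weight 2 g j + 1 − 2 f i.  The total weight of a matrix is a
-- function of its row and column sums, and the staircase, which selects exactly the
-- cells of positive weight, is its only maximiser as no weight vanishes.
staircase-lonesum : ∀ {f : Fin n → ℕ} {g : Fin k → ℕ} {A} → IsStaircase f g A → Lonesum A
staircase-lonesum {f = f} {g} {A} st B rows cols = at-ext λ i j →
  exchange-≡ (at A i j) (at B i j) (pos i j) (neg i j)
    (sum-≤-≡ (le i) (sum-≤-≡ (λ i → sum-mono-≤ (le i)) total i) j)
  where
  -- An odd number against an even one: `p j` and `q i` never coincide, and a tie `f i ≡ g j` falls
  -- on the positive side, as the staircase requires.
  p = λ j → suc (2 * g j)
  q = λ i → 2 * f i
  u = λ i j → entry (at A i j)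
  v = λ i j → entry (at B i j)
  pos : ∀ i j → at A i j ≡ true → q i < p j
  pos i j eq = s≤s (*-monoʳ-≤ 2 (at⇒≤ st i j eq))
  neg : ∀ i j → at A i j ≡ false → p j < q i
  neg i j eq = ≤-trans (≤-reflexive (sym (*-suc 2 (g j))))
    (*-monoʳ-≤ 2 (≰⇒> λ le → Bool.not-¬ (≤⇒at st i j le) eq))
  le : ∀ i j → v i j * p j + u i j * q i ≤ u i j * p j + v i j * q i
  le i j = exchange-≤ (at A i j) (at B i j) (pos i j) (neg i j)
  total : ∑ (λ i → ∑ λ j → v i j * p j + u i j * q i) ≡ ∑ (λ i → ∑ λ j → u i j * p j + v i j * q i)
  total = trans (∑∑-distrib-+ (λ i j → v i j * p j) (λ i j → u i j * q i)) (trans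
    (cong₂ _+_ (∑-column-weights v u p (columnSums-≡⁻ B A cols))
      (sym (∑-row-weights v u q (rowSums-≡⁻ B A rows))))
    (sym (∑∑-distrib-+ (λ i j → u i j * p j) (λ i j → v i j * q i))))

-- Swapping a permutation submatrix, and the chain of rows

δ : Fin n → Fin n → ℕ
δ x y = entry (does (x Fin.≟ y))

sum-δ : (y : Fin n) → ∑ (λ x → δ x y) ≡ 1
sum-δ {suc n} zero    = cong suc (sum-replicate-zero n)
sum-δ {suc n} (suc y) = sum-δ y

-- The `δ` terms on either side add up to `s + t` and cancel. Putting the losses of `u` on the left
-- and its gains on the right avoids subtraction.
sum-exchange : ∀ {u v : Fin n → ℕ} s t y y′ →
  (∀ x → u x + (s * δ x y + t * δ x y′) ≡ v x + (s * δ x y′ + t * δ x y)) → ∑ u ≡ ∑ v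
sum-exchange {n} {u} {v} s t y y′ eq =
  +-cancelʳ-≡ (s + t) _ _ (trans (sym (expand u y y′)) (trans (sum-cong-≗ eq) (expand v y′ y)))
  where
  scale : ∀ s y → ∑ (λ x → s * δ {n} x y) ≡ s
  scale s y = trans (sym (*-distribˡ-sum s (λ x → δ x y))) (trans (cong (s *_) (sum-δ y)) (*-identityʳ s))
  expand : ∀ u y y′ → ∑ (λ x → u x + (s * δ {n} x y + t * δ x y′)) ≡ ∑ u + (s + t)
  expand u y y′ = trans (∑-distrib-+ u _)
    (cong (∑ u +_) (trans (∑-distrib-+ (λ x → s * δ x y) (λ x → t * δ x y′))
      (cong₂ _+_ (scale s y) (scale t y′))))

module _ (A : Matrix n k) {i i′ : Fin n} {j j′ : Fin k}
  (ij : at A i j ≡ true) (i′j′ : at A i′ j′ ≡ true)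
    (ij′ : at A i j′ ≡ false) (i′j : at A i′ j ≡ false) where

  private
    flipped : Fin n → Fin k → Bool
    flipped x y = if (does (x Fin.≟ i) ∨ does (x Fin.≟ i′)) ∧ (does (y Fin.≟ j) ∨ does (y Fin.≟ j′))
                  then not (at A x y) else at A x y

    i≢i′ : i ≢ i′
    i≢i′ refl = Bool.not-¬ ij i′j

    j≢j′ : j ≢ j′
    j≢j′ refl = Bool.not-¬ ij ij′

    -- One identity records the whole swap: the cells (i , j) and (i′ , j′) lose 1, the cells (i ,
    -- j′) and (i′ , j) gain 1. Summed over `y` it preserves row sums, summed over `x` column sums.
    flipped-δ : ∀ x y → entry (flipped x y) + (δ x i * δ y j + δ x i′ * δ y j′)
                      ≡ entry (at A x y) + (δ x i * δ y j′ + δ x i′ * δ y j)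
    flipped-δ x y with x Fin.≟ i | x Fin.≟ i′ | y Fin.≟ j | y Fin.≟ j′
    ... | yes refl | yes refl | _ | _ = contradiction refl i≢i′
    ... | _ | _ | yes refl | yes refl = contradiction refl j≢j′
    ... | yes refl | no _ | yes refl | no _ rewrite ij = refl
    ... | yes refl | no _ | no _ | yes refl rewrite ij′ = refl
    ... | no _ | yes refl | yes refl | no _ rewrite i′j = refl
    ... | no _ | yes refl | no _ | yes refl rewrite i′j′ = refl
    ... | yes refl | no _ | no _ | no _ = refl
    ... | no _ | yes refl | no _ | no _ = refl
    ... | no _ | no _ | yes refl | no _ = refl
    ... | no _ | no _ | no _ | yes refl = refl
    ... | no _ | no _ | no _ | no _ = refl

    row : ∀ x → ∑ (entry ∘ flipped x) ≡ ∑ (entry ∘ at A x)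
    row x = sum-exchange (δ x i) (δ x i′) j j′ (flipped-δ x)

    column : ∀ y → ∑ (λ x → entry (flipped x y)) ≡ ∑ (λ x → entry (at A x y))
    column y = sum-exchange (δ y j) (δ y j′) i i′ λ x → subst₂ _≡_
      (cong (entry (flipped x y) +_) (cong₂ _+_ (*-comm (δ x i) (δ y j)) (*-comm (δ x i′) (δ y j′))))
      (cong (entry (at A x y) +_) (trans (+-comm (δ x i * δ y j′) (δ x i′ * δ y j))
        (cong₂ _+_ (*-comm (δ x i′) (δ y j)) (*-comm (δ x i) (δ y j′)))))
      (flipped-δ x y)

    flipped-ij : flipped i j ≡ false
    flipped-ij with i Fin.≟ i | j Fin.≟ j
    ... | yes _ | yes _ rewrite ij = refl
    ... | no i≢i | _ = contradiction refl i≢i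
    ... | _ | no j≢j = contradiction refl j≢j

  permutation-submatrix⇒¬lonesum : ¬ Lonesum A
  permutation-submatrix⇒¬lonesum lonesum = Bool.not-¬ ij (trans
    (sym (cong (λ M → at M i j) (lonesum (fromEntries flipped)
      (rowSums-≡⁺ (fromEntries flipped) A λ x →
        trans (sum-cong-≗ (cong entry ∘ at-fromEntries flipped x)) (row x))
      (columnSums-≡⁺ (fromEntries flipped) A λ y →
        trans (sum-cong-≗ λ x → cong entry (at-fromEntries flipped x y)) (column y)))))
    (trans (at-fromEntries flipped i j) flipped-ij))

⊆-or-witness : ∀ (p q : Subset n) → p ⊆ q ⊎ ∃ λ i → i ∈ p × i ∉ q
⊆-or-witness p q with Fin.any? (λ i → i ∈? p ×-dec ¬? (i ∈? q))
... | yes w = inj₂ w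
... | no ¬w = inj₁ sub
  where
  sub : p ⊆ q
  sub {i} i∈p with i ∈? q
  ... | yes i∈q = i∈q
  ... | no  i∉q = contradiction (i , i∈p , i∉q) ¬w

∉⇒lookup : ∀ {p : Subset n} {i} → i ∉ p → lookup p i ≡ false
∉⇒lookup {p = p} {i} i∉p = Bool.¬-not (i∉p ∘ lookup⇒[]= i p)

-- A row is read as the set of columns where it has a 1. Two incomparable rows each have a column
-- that the other lacks, and these two columns cut out a permutation submatrix.
lonesum-chain : ∀ {A : Matrix n k} → Lonesum A → ∀ i i′ →
  lookup A i ⊆ lookup A i′ ⊎ lookup A i′ ⊆ lookup A i
lonesum-chain {A = A} lonesum i i′ with ⊆-or-witness (lookup A i) (lookup A i′)
  | ⊆-or-witness (lookup A i′) (lookup A i)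
... | inj₁ sub | _ = inj₁ sub
... | _ | inj₁ sub = inj₂ sub
... | inj₂ (j , j∈i , j∉i′) | inj₂ (j′ , j′∈i′ , j′∉i) = contradiction lonesum
  (permutation-submatrix⇒¬lonesum A ([]=⇒lookup j∈i) ([]=⇒lookup j′∈i′) (∉⇒lookup j′∉i) (∉⇒lookup j∉i′))

-- Staircases and their levels

-- Two vectors and two predicates are needed because the size of a fibre counts the `inside` entries
-- of a subset, while the bound on types counts rows of a matrix.
count-mono-≤ : ∀ {A B : Set} {P : A → Set} {Q : B → Set} (P? : Decidable P) (Q? : Decidable Q)
  (xs : Vec A n) (ys : Vec B n) → (∀ i → P (lookup xs i) → Q (lookup ys i)) → count P? xs ≤ count Q? ys
count-mono-≤ P? Q? []       []       _   = z≤n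
count-mono-≤ P? Q? (x ∷ xs) (y ∷ ys) P⇒Q with P? x | Q? y | count-mono-≤ P? Q? xs ys (P⇒Q ∘ suc)
... | yes _ | yes _ | ih = s≤s ih
... | yes p | no ¬q | ih = contradiction (P⇒Q zero p) ¬q
... | no _  | yes _ | ih = m≤n⇒m≤1+n ih
... | no _  | no _  | ih = ih

count≡0 : ∀ {A : Set} {P : A → Set} (P? : Decidable P) (xs : Vec A n) →
  (∀ i → ¬ P (lookup xs i)) → count P? xs ≡ 0
count≡0 P? []       _  = refl
count≡0 P? (x ∷ xs) ¬P with P? x
... | yes p = contradiction p (¬P zero)
... | no _  = count≡0 P? xs (¬P ∘ suc)

module _ (B : Matrix n k) {f : Fin n → ℕ} where

  -- All rows of one type lie in a single fibre of `f`; a type that does not occur is counted zero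
  -- times.
  atMostRows⁺ : IsLevelling d m f → (∀ i i′ → lookup B i ≡ lookup B i′ → f i ≡ f i′) →
    AtMostRowsOfSameType d B
  atMostRows⁺ lv inj t with Fin.any? (λ i → ≡-dec Bool._≟_ (lookup B i) t)
  ... | no ¬e = ≤-trans (≤-reflexive (count≡0 _ B λ i e → ¬e (i , e))) z≤n
  ... | yes (i , refl) = ≤-trans
    (count-mono-≤ _ (Bool._≟ inside) B (fiber f (f i)) λ i′ e → []=⇒lookup (∈-fiber⁺ f (inj i′ i e)))
    (IsLevelling.small lv (IsLevelling.bounded lv i))

  atMostRows⁻ : AtMostRowsOfSameType d B → (∀ i i′ → f i ≡ f i′ → lookup B i ≡ lookup B i′) →
    (∃ λ i → f i ≡ a) → ∣ fiber f a ∣ ≤ d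
  atMostRows⁻ atMost eq (i , refl) = ≤-trans
    (count-mono-≤ (Bool._≟ inside) (λ r → ≡-dec Bool._≟_ r (lookup B i)) (fiber f (f i)) B
      λ i′ e → eq i′ i (∈-fiber⁻ f (lookup⇒[]= i′ _ e)))
    (atMost (lookup B i))

module _ {A : Matrix n k} {f : Fin n → ℕ} {g : Fin k → ℕ} (st : IsStaircase f g A) where

  staircase-rows-≡ : ∀ i i′ → f i ≡ f i′ → lookup A i ≡ lookup A i′
  staircase-rows-≡ i i′ eq = lookup-ext λ j → Bool.⇔→≡ (mk⇔
    (≤⇒at st i′ j ∘ subst (_≤ g j) eq ∘ at⇒≤ st i j)
    (≤⇒at st i j ∘ subst (_≤ g j) (sym eq) ∘ at⇒≤ st i′ j))

  staircase-columns-≡ : ∀ j j′ → g j ≡ g j′ → lookup (transpose A) j ≡ lookup (transpose A) j′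
  staircase-columns-≡ j j′ eq = lookup-ext λ i →
    trans (at-transpose A i j) (trans (Bool.⇔→≡ (mk⇔
      (≤⇒at st i j′ ∘ subst (f i ≤_) eq ∘ at⇒≤ st i j)
      (≤⇒at st i j ∘ subst (f i ≤_) (sym eq) ∘ at⇒≤ st i j′)))
    (sym (at-transpose A i j′)))

  module _ (lf : IsLevelling d m f) (lg : IsLevelling d m g) where
    private
      module F = IsLevelling lf
      module G = IsLevelling lg

    column-at-level : ∀ i → ∃ λ j → g j ≡ f i
    column-at-level i = G.onto (F.bounded i)

    row-at-level : ∀ j → ∃ λ i → f i ≡ g j
    row-at-level j = F.onto (G.bounded j)

    -- A column at exactly the level of row `i` has a 1 in row `i`, and all its ones lie in rows of
    -- level at most `f i`. Such a column exists because rows and columns share the same `m`.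
    rows-≡⇒≤ : ∀ i i′ → lookup A i ≡ lookup A i′ → f i′ ≤ f i
    rows-≡⇒≤ i i′ eq = let j , gj≡fi = column-at-level i in subst (f i′ ≤_) gj≡fi
      (at⇒≤ st i′ j (trans (sym (cong (flip lookup j) eq)) (≤⇒at st i j (≤-reflexive (sym gj≡fi)))))

    columns-≡⇒≤ : ∀ j j′ → lookup (transpose A) j ≡ lookup (transpose A) j′ → g j ≤ g j′
    columns-≡⇒≤ j j′ eq = let i , fi≡gj = row-at-level j in subst (_≤ g j′) fi≡gj
      (at⇒≤ st i j′ (trans (sym (at-transpose A i j′)) (trans (sym (cong (flip lookup i) eq))
        (trans (at-transpose A i j) (≤⇒at st i j (≤-reflexive fi≡gj))))))

    staircase-𝓛≤ : 𝓛≤ d n k A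
    staircase-𝓛≤ = record
      { lonesum       = staircase-lonesum st
      ; noZeroRow     = VecAll.lookup⁻ λ i zero-row → let j , gj≡fi = column-at-level i in
          Bool.not-¬ (≤⇒at st i j (≤-reflexive (sym gj≡fi)))
            (trans (cong (flip lookup j) zero-row) (lookup-replicate j false))
      ; noZeroColumn  = VecAll.lookup⁻ λ j zero-column → let i , fi≡gj = row-at-level j in
          Bool.not-¬ (≤⇒at st i j (≤-reflexive fi≡gj))
            (trans (sym (at-transpose A i j))
              (trans (cong (flip lookup i) zero-column) (lookup-replicate i false)))
      ; columnsOfType = atMostRows⁺ (transpose A) lg λ j j′ eq →
          ≤-antisym (columns-≡⇒≤ j j′ eq) (columns-≡⇒≤ j′ j (sym eq))
      ; rowsOfType    = atMostRows⁺ A lf λ i i′ eq →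
          ≤-antisym (rows-≡⇒≤ i′ i (sym eq)) (rows-≡⇒≤ i i′ eq)
      }

-- A row strictly below another is separated from it by a column, so the two row
-- levellings induce the same order on rows.
module _ {A : Matrix n k} {m m′ : ℕ} {f f′ : Fin n → ℕ} {g g′ : Fin k → ℕ}
  (st : IsStaircase f g A) (lf : IsLevelling d m f) (lg : IsLevelling d m g)
  (st′ : IsStaircase f′ g′ A) (lf′ : IsLevelling d m′ f′) where

  rowLevel-≤ : ∀ i → f i ≤ f′ i
  rowLevel-≤ i = go (f i) i refl
    where
    module F = IsLevelling lf
    go : ∀ a i → f i ≡ a → a ≤ f′ i
    go zero    i _  = z≤n
    -- Take a row `i₀` of level `a` and a column `j` of the same level. Column `j` has a 1 in row
    -- `i₀` but a 0 in row `i`, so `f′ i₀ ≤ g′ j < f′ i`, and each step of the induction gains at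
    -- least one level of `f′`.
    go (suc a) i fi≡1+a with F.onto (<-trans (n<1+n a) (subst (_< m) fi≡1+a (F.bounded i)))
    ... | i₀ , fi₀≡a with column-at-level st lf lg i₀
    ... | j , gj≡fi₀ = ≤-<-trans (go a i₀ fi₀≡a) (≤-<-trans
      (at⇒≤ st′ i₀ j (≤⇒at st i₀ j (≤-reflexive (sym gj≡fi₀))))
      (≰⇒> λ f′i≤g′j → <⇒≱ (≤-reflexive (trans (cong suc (trans gj≡fi₀ fi₀≡a)) (sym fi≡1+a)))
        (at⇒≤ st i j (≤⇒at st′ i j f′i≤g′j))))

  columnLevel-≤ : f ≗ f′ → ∀ j → g j ≤ g′ j
  columnLevel-≤ f≗f′ j = let i , fi≡gj = row-at-level st lf lg j in
    subst (_≤ g′ j) (trans (sym (f≗f′ i)) fi≡gj)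
      (at⇒≤ st′ i j (≤⇒at st i j (≤-reflexive fi≡gj)))

  levels-≤ : f ≗ f′ → m ≤ m′
  levels-≤ f≗f′ = ≮⇒≥ λ m′<m → let i , fi≡m′ = IsLevelling.onto lf m′<m in
    <-irrefl (trans (sym (f≗f′ i)) fi≡m′) (IsLevelling.bounded lf′ i)

staircase-unique : ∀ {A : Matrix n k} {m m′ f f′ g g′} →
  IsStaircase f g A → IsLevelling d m f → IsLevelling d m g →
  IsStaircase f′ g′ A → IsLevelling d m′ f′ → IsLevelling d m′ g′ →
  m ≡ m′ × f ≗ f′ × g ≗ g′
staircase-unique {f = f} {f′} st lf lg st′ lf′ lg′ =
  ≤-antisym (levels-≤ st lf lg st′ lf′ f≗f′) (levels-≤ st′ lf′ lg′ st lf (sym ∘ f≗f′)) ,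
  f≗f′ ,
  λ j → ≤-antisym (columnLevel-≤ st lf lg st′ lf′ f≗f′ j) (columnLevel-≤ st′ lf′ lg′ st lf (sym ∘ f≗f′) j)
  where
  f≗f′ : f ≗ f′
  f≗f′ i = ≤-antisym (rowLevel-≤ st lf lg st′ lf′ i) (rowLevel-≤ st′ lf′ lg′ st lf i)

-- Choosing a representative of each level is injective. For rows and columns together this bounds
-- `m` by `n ⊓ k`, where the summation ends.
levelling⇒≤ : ∀ {f : Fin n → ℕ} → IsLevelling d m f → m ≤ n
levelling⇒≤ {f = f} lv = Fin.injective⇒≤ {f = λ a → proj₁ (onto (Fin.toℕ<n a))}
  λ {a} {b} eq → Fin.toℕ-injective (trans (sym (proj₂ (onto (Fin.toℕ<n a))))
    (trans (cong f eq) (proj₂ (onto (Fin.toℕ<n b)))))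
  where open IsLevelling lv

-- Were `b` missed, punching it out of the codomain would embed `Fin (suc m)` into `Fin m`.
injective⇒surjective : ∀ {f : Fin m → Fin m} → Injective _≡_ _≡_ f → ∀ b → ∃ λ a → f a ≡ b
injective⇒surjective {suc m} {f} inj b with Fin.any? (λ a → f a Fin.≟ b)
... | yes w = w
... | no ¬w = contradiction
  (Fin.injective⇒≤ {f = λ a → punchOut (b≢ a)}
    λ {a} {a′} eq → inj (Fin.punchOut-injective (b≢ a) (b≢ a′) eq))
  1+n≰n
  where
  b≢ : ∀ a → b ≢ f a
  b≢ a eq = ¬w (a , sym eq)

module _ {A : Set} {P Q : A → Set} (P? : Decidable P) (Q? : Decidable Q) where

  length-filter-mono-≤ : ∀ xs → (∀ {x} → x ∈ˡ xs → P x → Q x) →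
    length (filter P? xs) ≤ length (filter Q? xs)
  length-filter-mono-≤ []       _   = z≤n
  length-filter-mono-≤ (x ∷ xs) P⇒Q with P? x | Q? x | length-filter-mono-≤ xs (P⇒Q ∘ there)
  ... | yes _ | yes _ | ih = s≤s ih
  ... | yes p | no ¬q | ih = contradiction (P⇒Q (here refl) p) ¬q
  ... | no _  | yes _ | ih = m≤n⇒m≤1+n ih
  ... | no _  | no _  | ih = ih

  length-filter-mono-< : ∀ {xs y} → (∀ {x} → x ∈ˡ xs → P x → Q x) → y ∈ˡ xs → ¬ P y → Q y →
    length (filter P? xs) < length (filter Q? xs)
  length-filter-mono-< {x ∷ xs} P⇒Q (here refl) ¬p q with P? x | Q? x
  ... | yes p | _     = contradiction p ¬p
  ... | no _  | yes _ = s≤s (length-filter-mono-≤ xs (P⇒Q ∘ there))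
  ... | no _  | no ¬q = contradiction q ¬q
  length-filter-mono-< {x ∷ xs} P⇒Q (there y∈) ¬p q with P? x | Q? x
    | length-filter-mono-< (P⇒Q ∘ there) y∈ ¬p q
  ... | yes _ | yes _ | ih = s≤s ih
  ... | yes p | no ¬q | ih = contradiction (P⇒Q (here refl) p) ¬q
  ... | no _  | yes _ | ih = m≤n⇒m≤1+n ih
  ... | no _  | no _  | ih = ih

lookup-injective : ∀ {A : Set} {xs : List A} → Unique xs → Injective _≡_ _≡_ (List.lookup xs)
lookup-injective (_  ∷ _)   {zero}  {zero}  _  = refl
lookup-injective (x∉ ∷ _)   {zero}  {suc b} eq = contradiction eq (All.lookup x∉ (∈-lookup b))
lookup-injective (x∉ ∷ _)   {suc a} {zero}  eq = contradiction (sym eq) (All.lookup x∉ (∈-lookup a))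
lookup-injective (_  ∷ xs!) {suc a} {suc b} eq = cong suc (lookup-injective xs! eq)

-- The level of a row counts the row types not contained in it; a column belongs to
-- exactly one more row type than its level.
module _ {A : Matrix n k} (A∈𝓛 : 𝓛≤ d n k A) where
  open 𝓛≤ A∈𝓛

  private
    types : List (Subset k)
    types = deduplicate (≡-dec Bool._≟_) (List.tabulate (lookup A))

    M : ℕ
    M = length types

    row∈types : ∀ i → lookup A i ∈ˡ types
    row∈types i = ∈-deduplicate⁺ (≡-dec Bool._≟_) (∈-tabulate⁺ {f = lookup A} i)

    types⇒row : ∀ {t} → t ∈ˡ types → ∃ λ i → t ≡ lookup A i
    types⇒row t∈ = ∈-tabulate⁻ (∈-deduplicate⁻ (≡-dec Bool._≟_) (List.tabulate (lookup A)) t∈)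

    chain : ∀ {s t} → s ∈ˡ types → t ∈ˡ types → s ⊆ t ⊎ t ⊆ s
    chain s∈ t∈ with types⇒row s∈ | types⇒row t∈
    ... | i , refl | i′ , refl = lonesum-chain lonesum i i′

    rank : Subset k → ℕ
    rank s = length (filter (λ t → ¬? (t ⊆? s)) types)

    rank-anti-≤ : ∀ {s t} → s ⊆ t → rank t ≤ rank s
    rank-anti-≤ s⊆t = length-filter-mono-≤ _ _ types λ _ u⊈t u⊆s → u⊈t (⊆-trans u⊆s s⊆t)

    -- The type `t` itself is counted by `rank s` but not by `rank t`.
    rank-anti-< : ∀ {s t} → t ∈ˡ types → s ⊆ t → ¬ (t ⊆ s) → rank t < rank s
    rank-anti-< t∈ s⊆t t⊈s = length-filter-mono-< _ _
      (λ _ u⊈t u⊆s → u⊈t (⊆-trans u⊆s s⊆t)) t∈ (λ t⊈t → t⊈t ⊆-refl) t⊈s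

    rank<M : ∀ {s} → s ∈ˡ types → rank s < M
    rank<M s∈ = filter-notAll _ types (lose s∈ λ s⊈s → s⊈s ⊆-refl)

    rank-≡⇒⊆ : ∀ {s t} → s ∈ˡ types → t ∈ˡ types → rank s ≡ rank t → t ⊆ s
    rank-≡⇒⊆ {s} {t} s∈ t∈ eq with t ⊆? s | chain s∈ t∈
    ... | yes t⊆s | _        = t⊆s
    ... | no _    | inj₂ t⊆s = t⊆s
    ... | no t⊈s  | inj₁ s⊆t = contradiction (sym eq) (<⇒≢ (rank-anti-< t∈ s⊆t t⊈s))

    rank-injective : ∀ {s t} → s ∈ˡ types → t ∈ˡ types → rank s ≡ rank t → s ≡ t
    rank-injective s∈ t∈ eq = ⊆-antisym (rank-≡⇒⊆ t∈ s∈ (sym eq)) (rank-≡⇒⊆ s∈ t∈ eq)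

    f : Fin n → ℕ
    f i = rank (lookup A i)

    height : Fin k → ℕ
    height j = length (filter (j ∈?_) types)

    -- The predecessor never truncates: without zero columns every height is positive.
    g : Fin k → ℕ
    g j = pred (height j)

    -- By the chain property a type not contained in row `i` contains row `i`, and with it `j`. Row
    -- `i` itself is the extra type that makes the inequality strict.
    ∈⇒f<height : ∀ {i j} → j ∈ lookup A i → f i < height j
    ∈⇒f<height {i} {j} j∈ = length-filter-mono-< _ _ above (row∈types i) (λ ⊈ → ⊈ ⊆-refl) j∈
      where
      above : ∀ {t} → t ∈ˡ types → ¬ (t ⊆ lookup A i) → j ∈ t
      above t∈ t⊈ with chain t∈ (row∈types i)
      ... | inj₁ t⊆ = contradiction (λ {x} → t⊆ {x}) t⊈
      ... | inj₂ ⊆t = ⊆t j∈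

    ∉⇒height≤f : ∀ {i j} → j ∉ lookup A i → height j ≤ f i
    ∉⇒height≤f j∉ = length-filter-mono-≤ _ _ types λ _ j∈t t⊆ → j∉ (t⊆ j∈t)

    row-nonempty : ∀ i → Nonempty (lookup A i)
    row-nonempty i with nonempty? (lookup A i)
    ... | yes ne = ne
    ... | no  em = contradiction (Empty-unique em) (VecAll.lookup⁺ noZeroRow i)

    column-nonempty : ∀ j → ∃ λ i → j ∈ lookup A i
    column-nonempty j with nonempty? (lookup (transpose A) j)
    ... | yes (i , i∈) = i , lookup⇒[]= j _ (trans (sym (at-transpose A i j)) ([]=⇒lookup i∈))
    ... | no  em = contradiction (Empty-unique em) (VecAll.lookup⁺ noZeroColumn j)

    height≡1+g : ∀ j → height j ≡ suc (g j)
    height≡1+g j with height j | ∈⇒f<height (proj₂ (column-nonempty j))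
    ... | suc _ | _ = refl

    height≤M : ∀ j → height j ≤ M
    height≤M j = length-filter (j ∈?_) types

    levels-isStaircase : IsStaircase f g A
    levels-isStaircase .at⇒≤ i j eq = s≤s⁻¹ (subst (f i <_) (height≡1+g j) (∈⇒f<height (lookup⇒[]= j _ eq)))
    levels-isStaircase .≤⇒at i j fi≤gj = Bool.¬-not λ eq → <⇒≱ (s≤s fi≤gj) (subst (_≤ f i) (height≡1+g j)
        (∉⇒height≤f λ j∈ → Bool.not-¬ ([]=⇒lookup j∈) eq))

    -- `rank` sends the `M` distinct types injectively to numbers below `M`, hence onto them.
    onto-f : a < M → ∃ λ i → f i ≡ a
    onto-f a<M with injective⇒surjective {f = index} index-injective (fromℕ< a<M)
      where
      index : Fin M → Fin M
      index c = fromℕ< (rank<M (∈-lookup c))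
      index-injective : Injective _≡_ _≡_ index
      index-injective {c} {c′} eq = lookup-injective (deduplicate-! (≡-dec Bool._≟_) (List.tabulate (lookup A)))
        (rank-injective (∈-lookup c) (∈-lookup c′) (Fin.fromℕ<-injective _ _ _ _ eq))
    ... | c , eq with types⇒row (∈-lookup c)
    ... | i , t≡row = i , trans (cong rank (sym t≡row)) (Fin.fromℕ<-injective _ _ _ _ eq)

    onto-g : a < M → ∃ λ j → g j ≡ a
    onto-g {a} a<M with onto-f a<M | m≤n⇒m<n∨m≡n a<M
    -- Last level: row `i` is the smallest type. It is not zero, and any column `j` in it has height
    -- above `a`, hence height `M`.
    ... | i , fi≡a | inj₂ 1+a≡M = let j , j∈ = row-nonempty i in
      j , suc-injective (trans (sym (height≡1+g j)) (≤-antisym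
        (≤-trans (height≤M j) (≤-reflexive (sym 1+a≡M)))
        (subst (λ c → suc c ≤ height j) fi≡a (∈⇒f<height j∈))))
    -- Otherwise there is a row `i′` one level further, and a column in row `i` but not in row `i′`
    -- has height above `a` and at most `suc a`.
    ... | i , fi≡a | inj₁ 1+a<M with onto-f 1+a<M
    ... | i′ , fi′≡1+a with ⊆-or-witness (lookup A i) (lookup A i′)
    ... | inj₁ sub = contradiction (subst₂ _≤_ fi′≡1+a fi≡a (rank-anti-≤ sub)) 1+n≰n
    ... | inj₂ (j , j∈ , j∉) = j , suc-injective (trans (sym (height≡1+g j)) (≤-antisym
        (≤-trans (∉⇒height≤f j∉) (≤-reflexive fi′≡1+a))
        (subst (λ c → suc c ≤ height j) fi≡a (∈⇒f<height j∈))))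

  𝓛≤-staircase : ∃ λ m → ∃₂ λ f g → IsLevelling d m f × IsLevelling d m g × IsStaircase f g A
  𝓛≤-staircase = M , f , g ,
    record
      { bounded = rank<M ∘ row∈types
      ; onto    = onto-f
      ; small   = λ a<M → atMostRows⁻ A rowsOfType (staircase-rows-≡ levels-isStaircase) (onto-f a<M)
      } ,
    record
      { bounded = λ j → subst (_≤ M) (height≡1+g j) (height≤M j)
      ; onto    = onto-g
      ; small   = λ a<M → atMostRows⁻ (transpose A) columnsOfType
          (staircase-columns-≡ levels-isStaircase) (onto-g a<M)
      } ,
    levels-isStaircase

-- Enumerating the pairs of ordered partitions

-- Injectivity is asked only on the list, since `staircase` is shown injective on pairs of ordered
-- partitions, not on arbitrary pairs of lists.
map-unique : (f : A → B) {xs : List A} → (∀ {x y} → x ∈ˡ xs → y ∈ˡ xs → f x ≡ f y → x ≡ y) →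
  Unique xs → Unique (map f xs)
map-unique f inj []         = []
map-unique f inj (x∉ ∷ xs!) =
  All.map⁺ (All.tabulate λ y∈ eq → All.lookup x∉ y∈ (inj (here refl) (there y∈) eq)) ∷
  map-unique f (λ p q → inj (there p) (there q)) xs!

length-concatMap : (f : A → List B) → ∀ xs → length (concatMap f xs) ≡ sum (map (length ∘ f) xs)
length-concatMap f []       = refl
length-concatMap f (x ∷ xs) = trans (length-++ (f x)) (cong (length (f x) +_) (length-concatMap f xs))

length-cartesianProduct : ∀ (xs : List A) (ys : List B) →
  length (cartesianProduct xs ys) ≡ length xs * length ys
length-cartesianProduct []       ys = refl
length-cartesianProduct (x ∷ xs) ys = trans (length-++ (map (x ,_) ys))
  (cong₂ _+_ (length-map (x ,_) ys) (length-cartesianProduct xs ys))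

staircase : List (Subset n) × List (Subset k) → Matrix n k
staircase (X , Y) = fromEntries λ i j → level X i ≤ᵇ level Y j

staircase-isStaircase : ∀ (X : List (Subset n)) (Y : List (Subset k)) →
  IsStaircase (level X) (level Y) (staircase (X , Y))
staircase-isStaircase X Y .at⇒≤ i j eq = ≤ᵇ⇒≤ (level X i) (level Y j)
  (Equivalence.from Bool.T-≡ (trans (sym (at-fromEntries _ i j)) eq))
staircase-isStaircase X Y .≤⇒at i j le =
  trans (at-fromEntries _ i j) (Equivalence.to Bool.T-≡ (≤⇒≤ᵇ le))

IsPartitionPair : (d : ℕ) → List (Subset n) × List (Subset k) → Set
IsPartitionPair d (X , Y) = IsPartition≤ d X × IsPartition≤ d Y × length X ≡ length Y

staircase-∈𝓛≤ : ∀ {XY : List (Subset n) × List (Subset k)} →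
  IsPartitionPair d XY → 𝓛≤ d n k (staircase XY)
staircase-∈𝓛≤ {d = d} {X , Y} (pX , pY , |X|≡|Y|) = staircase-𝓛≤ (staircase-isStaircase X Y)
  (level-isLevelling pX)
  (subst (λ m → IsLevelling d m (level Y)) (sym |X|≡|Y|) (level-isLevelling pY))

staircase-injective : ∀ {XY XY′ : List (Subset n) × List (Subset k)} →
  IsPartitionPair d XY → IsPartitionPair d XY′ → staircase XY ≡ staircase XY′ → XY ≡ XY′
staircase-injective {d = d} {X , Y} {X′ , Y′} (pX , pY , |X|≡|Y|) (pX′ , pY′ , |X′|≡|Y′|) eq
  with staircase-unique
    (staircase-isStaircase X Y) (level-isLevelling pX)
    (subst (λ m → IsLevelling d m (level Y)) (sym |X|≡|Y|) (level-isLevelling pY))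
    (subst (IsStaircase _ _) (sym eq) (staircase-isStaircase X′ Y′)) (level-isLevelling pX′)
    (subst (λ m → IsLevelling d m (level Y′)) (sym |X′|≡|Y′|) (level-isLevelling pY′))
... | |X|≡|X′| , X≗X′ , Y≗Y′ = cong₂ _,_
  (level-injective pX pX′ |X|≡|X′| X≗X′)
  (level-injective pY pY′ (trans (sym |X|≡|Y|) (trans |X|≡|X′| |X′|≡|Y′|)) Y≗Y′)

pairsOfLength : (d n k m : ℕ) → List (List (Subset n) × List (Subset k))
pairsOfLength d n k m = cartesianProduct (orderedPartitions d n m) (orderedPartitions d k m)

pairs : (d n k : ℕ) → List (List (Subset n) × List (Subset k))
pairs d n k = concatMap (pairsOfLength d n k) (upTo (suc (n ⊓ k)))

∈-pairsOfLength⁻ : ∀ {XY : List (Subset n) × List (Subset k)} → XY ∈ˡ pairsOfLength d n k m →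
  IsPartitionPair d XY × length (proj₁ XY) ≡ m
∈-pairsOfLength⁻ {n} {k} {d} {m} {X , Y} XY∈ =
  let X∈ , Y∈     = ∈-cartesianProduct⁻ (orderedPartitions d n m) (orderedPartitions d k m) XY∈
      pX , |X|≡m = ∈-orderedPartitions⁻ {d = d} {m = m} X∈
      pY , |Y|≡m = ∈-orderedPartitions⁻ {d = d} {m = m} Y∈
  in (pX , pY , trans |X|≡m (sym |Y|≡m)) , |X|≡m

∈-pairs⁻ : ∀ {XY : List (Subset n) × List (Subset k)} → XY ∈ˡ pairs d n k → IsPartitionPair d XY
∈-pairs⁻ {n} {k} {d} XY∈ =
  let m , _ , XY∈′ = find (∈-concatMap⁻ (pairsOfLength d n k) {xs = upTo (suc (n ⊓ k))} XY∈)
  in proj₁ (∈-pairsOfLength⁻ {d = d} {m = m} XY∈′)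

pairs-unique : ∀ d n k → Unique (pairs d n k)
pairs-unique d n k = concatMap-unique
  (λ {m} _ → Unique.cartesianProduct⁺ (orderedPartitions-unique d n m) (orderedPartitions-unique d k m))
  (λ {m} {m′} _ _ p q → trans (sym (proj₂ (∈-pairsOfLength⁻ {d = d} {m = m} p)))
    (proj₂ (∈-pairsOfLength⁻ {d = d} {m = m′} q)))
  (Unique.upTo⁺ (suc (n ⊓ k)))

length-pairs : ∀ d n k →
  length (pairs d n k) ≡ sum (map (λ m → (m ! * S≤ d n m) * (m ! * S≤ d k m)) (upTo (suc (n ⊓ k))))
length-pairs d n k = trans (length-concatMap (pairsOfLength d n k) (upTo (suc (n ⊓ k))))
  (cong sum (map-cong (λ m → trans
    (length-cartesianProduct (orderedPartitions d n m) (orderedPartitions d k m))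
    (cong₂ _*_ (length-orderedPartitions d n m) (length-orderedPartitions d k m)))
    (upTo (suc (n ⊓ k)))))

𝓛≤⇒staircase : ∀ {A : Matrix n k} → 𝓛≤ d n k A → A ∈ˡ map staircase (pairs d n k)
𝓛≤⇒staircase {n} {k} {d} {A} A∈𝓛 with 𝓛≤-staircase A∈𝓛
... | m , f , g , lf , lg , st = subst (_∈ˡ map staircase (pairs d n k)) (sym A≡) (∈-map⁺ staircase
    (∈-concatMap⁺ (pairsOfLength d n k)
      (lose (∈-upTo⁺ (s≤s (⊓-glb (levelling⇒≤ lf) (levelling⇒≤ lg))))
        (∈-cartesianProduct⁺
          (∈-orderedPartitions⁺ (blocks-isPartition lf) (length-applyUpTo (fiber f) m))
          (∈-orderedPartitions⁺ (blocks-isPartition lg) (length-applyUpTo (fiber g) m))))))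
  where
  st′ = staircase-isStaircase (blocks f m) (blocks g m)
  A≡ : A ≡ staircase (blocks f m , blocks g m)
  A≡ = at-ext λ i j → Bool.⇔→≡ (mk⇔
    (λ eq → ≤⇒at st′ i j (subst₂ _≤_ (sym (level-blocks lf i)) (sym (level-blocks lg j))
      (at⇒≤ st i j eq)))
    (λ eq → ≤⇒at st i j (subst₂ _≤_ (level-blocks lf i) (level-blocks lg j) (at⇒≤ st′ i j eq))))

theorem2 : (d n k : ℕ) → d ≥ 1 →
    HasCardinality (𝓛≤ d n k)
    (sum (map (λ m → (m ! * S≤ d n m) * (m ! * S≤ d k m)) (upTo (suc (n ⊓ k)))))
theorem2 d n k _ =
  map staircase (pairs d n k) ,
  map-unique staircase (λ p q → staircase-injective (∈-pairs⁻ {d = d} p) (∈-pairs⁻ {d = d} q))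
    (pairs-unique d n k) ,
  (λ A → mk⇔ sound 𝓛≤⇒staircase) ,
  trans (length-map staircase (pairs d n k)) (length-pairs d n k)
  where
  sound : ∀ {A} → A ∈ˡ map staircase (pairs d n k) → 𝓛≤ d n k A
  sound A∈ with ∈-map⁻ staircase A∈
  ... | XY , XY∈ , refl = staircase-∈𝓛≤ (∈-pairs⁻ {d = d} XY∈)
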